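{- Let $\mathcal{L}\subseteq\mathbb{Z}^3$ be an order ideal with $\mathcal{L}\subseteq C(0,0,0)$ and $\mathcal{U}\cap C(0,0,0)$ finite, let $\mathcal{I}$ be as in the context, let $N$ be a cutoff for $\mathcal{I}$, and let $G$ be an $\mathcal{I}$-grove within radius $N$. Then every vertex of $G$ has degree between $1$ and $6$. Equivalently, in every monomial of the Laurent polynomial $f_{0,0,0}$, every variable $x_{i,j,k}$ appears with exponent in $\{ -1,0,1,2,3,4\}$.
   Context: For $(i,j,k)\in\mathbb{Z}^3$ let $C(i,j,k)=\{(i',j',k') : i'\le i,\ j'\le j,\ k'\le k\}$. $\mathcal{L}\subseteq\mathbb{Z}^3$ satisfies: $(i,j,k)\in\mathcal{L}\Rightarrow C(i,j,k)\subseteq\mathcal{L}$. $\mathcal{U}=\mathbb{Z}^3\setminus\mathcal{L}$, $\mathcal{I}=\{(i,j,k)\in\mathcal{L} : (i+1,j+1,k+1)\in\mathcal{U}\}$. Variables $x_{i,j,k}$ for $(i,j,k)\in\mathcal{I}$ and edge variables $a_{j,k},b_{i,k},c_{i,j}$. Define $f_{i,j,k}=x_{i,j,k}$ on $\mathcal{I}$, and for $(i,j,k)\in\mathcal{U}$ with $C(i,j,k)\cap\mathcal{U}$ finite, $f_{i,j,k}f_{i-1,j-1,k-1}=b_{i,k}c_{i,j}f_{i-1,j,k}f_{i,j-1,k-1}+c_{i,j}a_{j,k}f_{i,j-1,k}f_{i-1,j,k-1}+a_{j,k}b_{i,k}f_{i,j,k-1}f_{i-1,j-1,k}$; $f_{0,0,0}$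 is a Laurent polynomial in the $x$'s and edge variables. A cutoff for $\mathcal{I}$ is an integer $N$ such that (i) $(i,j,k)\in\mathcal{I}$ whenever $i+j+k\le -N$ and $\max\{i,j,k\}=0$; (ii) $(i,j,k)\notin\mathcal{I}$ whenever $i+j+k\le -N-3$ and $\max\{i,j,k\}<0$. For $(i,j,k)\in\mathcal{I}$ let $r_a(i,j,k)=\{(i,j,k),(i,j-1,k),(i,j,k-1),(i,j-1,k-1)\}$, $r_b(i,j,k)=\{(i,j,k),(i-1,j,k),(i,j,k-1),(i-1,j,k-1)\}$, $r_c(i,j,k)=\{(i,j,k),(i-1,j,k),(i,j-1,k),(i-1,j-1,k)\}$; a rhombus is such a set contained in $\mathcal{I}$. Long edges: $\{(i,j-1,k),(i,j,k-1)\}$, $\{(i-1,j,k),(i,j,k-1)\}$, $\{(i-1,j,k),(i,j-1,k)\}$; short edges: $\{(i,j,k),(i,j-1,k-1)\}$, $\{(i,j,k),(i-1,j,k-1)\}$, $\{(i,j,k),(i-1,j-1,k)\}$ (for $r_a,r_b,r_c$ respectively). $\mathcal{G}$ is the graph on $\mathcal{I}$ whose edges are the long and short edges of all rhombi. An $\mathcal{I}$-grove within radius $N$ is a subgraph $G\subseteq\mathcal{G}$ with: vertex set all of $\mathcal{I}$; for every rhombus exactly one of its two edges in $G$; for every rhombus all of whose vertices satisfy $i+j+k<-N$, its short edge in $G$; and every component of $G$ contains exactly one of the following sets, each of which lies in some component: $\{(0,p,q),(p,0,q)\}$, $\{(p,q,0),(0,q,p)\}$, $\{(q,0,p),(q,p,0)\}$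 for $0>p>q$, $p+q\in\{ -N-1,-N-2\}$; $\{(0,p,p),(p,0,p),(p,p,0)\}$ for $2p\in\{ -N-1,-N-2\}$; $\{(0,0,q)\},\{(0,q,0)\},\{(q,0,0)\}$ for $q\le -N-1$. -}

module Defs where

open import Data.Integer using (ℤ; +_; -_; _+_; _-_; _≤_; _<_; _⊔_; 0ℤ; 1ℤ)
open import Data.Bool using (Bool; true; false)
open import Data.Product using (Σ; Σ-syntax; _×_; _,_)
open import Data.Sum using (_⊎_)
open import Data.Nat using (ℕ)
open import Data.List using (List; length)
open import Data.List.Membership.Propositional using (_∈_)
open import Data.List.Relation.Unary.Unique.Propositional using (Unique)
open import Relation.Binary.Construct.Closure.ReflexiveTransitive using (Star)
open import Relation.Binary.PropositionalEquality using (_≡_)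
open import Relation.Nullary using (¬_)

Pt : Set
Pt = ℤ × ℤ × ℤ

-- componentwise order;  w ∈ C(v)  iff  w ≼ v
_≼_ : Pt → Pt → Set
(i , j , k) ≼ (i' , j' , k') = (i ≤ i') × (j ≤ j') × (k ≤ k')

origin : Pt
origin = 0ℤ , 0ℤ , 0ℤ

coordSum : Pt → ℤ
coordSum (i , j , k) = i + j + k

-- Subsets of ℤ³ are given by (decidable) characteristic functions.
-- L is the subset {v | L v ≡ true};  U = complement = {v | L v ≡ false}.

IsOrderIdeal : (Pt → Bool) → Set
IsOrderIdeal L = ∀ v w → w ≼ v → L v ≡ true → L w ≡ true

InsideOrigin : (Pt → Bool) → Set
InsideOrigin L = ∀ v → L v ≡ true → v ≼ origin

FiniteUBelowOrigin : (Pt → Bool) → Set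
FiniteUBelowOrigin L = Σ (List Pt) λ xs → ∀ v → v ≼ origin → L v ≡ false → v ∈ xs

InI : (Pt → Bool) → Pt → Set
InI L (i , j , k) = (L (i , j , k) ≡ true) × (L (i + 1ℤ , j + 1ℤ , k + 1ℤ) ≡ false)

IsCutoff : (Pt → Bool) → ℤ → Set
IsCutoff L N =
  (∀ i j k → i + j + k ≤ - N → (i ⊔ j) ⊔ k ≡ 0ℤ → InI L (i , j , k)) ×
  (∀ i j k → i + j + k ≤ (- N) - + 3 → (i ⊔ j) ⊔ k < 0ℤ → ¬ InI L (i , j , k))

data RType : Set where
  ra rb rc : RType

record Four (A : Set) : Set where
  constructor four
  field
    v₁ v₂ v₃ v₄ : A

rverts : RType → Pt → Four Pt
rverts ra (i , j , k) = four (i , j , k) (i , j - 1ℤ , k) (i , j , k - 1ℤ) (i , j - 1ℤ , k - 1ℤ)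
rverts rb (i , j , k) = four (i , j , k) (i - 1ℤ , j , k) (i , j , k - 1ℤ) (i - 1ℤ , j , k - 1ℤ)
rverts rc (i , j , k) = four (i , j , k) (i - 1ℤ , j , k) (i , j - 1ℤ , k) (i - 1ℤ , j - 1ℤ , k)

AllFour : (Pt → Set) → Four Pt → Set
AllFour P (four a b c d) = P a × P b × P c × P d

IsRhombus : (Pt → Bool) → RType → Pt → Set
IsRhombus L t u = AllFour (InI L) (rverts t u)

longEdge : RType → Pt → Pt × Pt
longEdge ra (i , j , k) = (i , j - 1ℤ , k) , (i , j , k - 1ℤ)
longEdge rb (i , j , k) = (i - 1ℤ , j , k) , (i , j , k - 1ℤ)
longEdge rc (i , j , k) = (i - 1ℤ , j , k) , (i , j - 1ℤ , k)

shortEdge : RType → Pt → Pt × Pt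
shortEdge ra (i , j , k) = (i , j , k) , (i , j - 1ℤ , k - 1ℤ)
shortEdge rb (i , j , k) = (i , j , k) , (i - 1ℤ , j , k - 1ℤ)
shortEdge rc (i , j , k) = (i , j , k) , (i - 1ℤ , j - 1ℤ , k)

IsPair : Pt → Pt → Pt × Pt → Set
IsPair v w e = (e ≡ (v , w)) ⊎ (e ≡ (w , v))

GEdge : (Pt → Bool) → Pt → Pt → Set
GEdge L v w = Σ RType λ t → Σ Pt λ u → IsRhombus L t u ×
  (IsPair v w (longEdge t u) ⊎ IsPair v w (shortEdge t u))

-- a subgraph G with vertex set 𝓘 is given by its (symmetric, decidable) edge relation E
EdgeIn : (Pt → Pt → Bool) → Pt × Pt → Set
EdgeIn E (v , w) = E v w ≡ true

EdgeOut : (Pt → Pt → Bool) → Pt × Pt → Set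
EdgeOut E (v , w) = E v w ≡ false

Conn : (Pt → Pt → Bool) → Pt → Pt → Set
Conn E = Star (λ v w → E v w ≡ true)

data BSet : Set where
  pairA pairB pairC : ℤ → ℤ → BSet
  triple : ℤ → BSet
  singleA singleB singleC : ℤ → BSet

PairCond : ℤ → ℤ → ℤ → Set
PairCond N p q = (p < 0ℤ) × (q < p) × ((p + q ≡ (- N) - 1ℤ) ⊎ (p + q ≡ (- N) - + 2))

ValidB : ℤ → BSet → Set
ValidB N (pairA p q) = PairCond N p q
ValidB N (pairB p q) = PairCond N p q
ValidB N (pairC p q) = PairCond N p q
ValidB N (triple p) = (p + p ≡ (- N) - 1ℤ) ⊎ (p + p ≡ (- N) - + 2)
ValidB N (singleA q) = q ≤ (- N) - 1ℤ
ValidB N (singleB q) = q ≤ (- N) - 1ℤ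
ValidB N (singleC q) = q ≤ (- N) - 1ℤ

MemB : BSet → Pt → Set
MemB (pairA p q) w = (w ≡ (0ℤ , p , q)) ⊎ (w ≡ (p , 0ℤ , q))
MemB (pairB p q) w = (w ≡ (p , q , 0ℤ)) ⊎ (w ≡ (0ℤ , q , p))
MemB (pairC p q) w = (w ≡ (q , 0ℤ , p)) ⊎ (w ≡ (q , p , 0ℤ))
MemB (triple p) w = (w ≡ (0ℤ , p , p)) ⊎ (w ≡ (p , 0ℤ , p)) ⊎ (w ≡ (p , p , 0ℤ))
MemB (singleA q) w = w ≡ (0ℤ , 0ℤ , q)
MemB (singleB q) w = w ≡ (0ℤ , q , 0ℤ)
MemB (singleC q) w = w ≡ (q , 0ℤ , 0ℤ)

CompContains : (Pt → Pt → Bool) → Pt → BSet → Set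
CompContains E v s = ∀ w → MemB s w → Conn E v w

record IsGrove (L : Pt → Bool) (N : ℤ) (E : Pt → Pt → Bool) : Set where
  field
    symmetric : ∀ v w → E v w ≡ E w v
    subgraph  : ∀ v w → E v w ≡ true → GEdge L v w
    exactlyOne : ∀ t u → IsRhombus L t u →
      (EdgeIn E (longEdge t u) × EdgeOut E (shortEdge t u)) ⊎
      (EdgeOut E (longEdge t u) × EdgeIn E (shortEdge t u))
    farShort : ∀ t u → IsRhombus L t u →
      AllFour (λ w → coordSum w < - N) (rverts t u) → EdgeIn E (shortEdge t u)
    setsConnected : ∀ s → ValidB N s →
      (∀ w → MemB s w → InI L w) × (∀ w w' → MemB s w → MemB s w' → Conn E w w')
    exactlyOneSet : ∀ v → InI L v →
      Σ BSet λ s → ValidB N s × CompContains E v s ×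
        (∀ s' → ValidB N s' → CompContains E v s' → s' ≡ s)

HasDegree : (Pt → Pt → Bool) → Pt → ℕ → Set
HasDegree E v d = Σ (List Pt) λ ws → Unique ws ×
  (∀ w → w ∈ ws → E v w ≡ true) × (∀ w → E v w ≡ true → w ∈ ws) × (length ws ≡ d)

-- Upper bound: every edge of 𝓖 at v leads to v + d, where d is read off from one of the six
-- points v + c of the unit cube above v other than v and v + (1,1,1): whether v + c lies in 𝓛
-- decides which of two directions is possible for c.  So 𝓖, and a fortiori every grove, has
-- degree at most 6.
-- Lower bound: the component of v contains a distinguished set, one of whose points w lies on a
-- coordinate face beyond the cutoff.  If v ≠ w the path from v to w starts with an edge at v;
-- if v = w, the rhombus below w inside that face is far out, so its short edge at w is in G.
module Submission where

open import Defs
open import Data.Bool using (Bool)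
open import Data.Integer using (ℤ)
open import Data.Nat using (ℕ; _≤_)
open import Data.Product using (Σ; _×_)

open import Data.Bool using (true; false)
open import Data.Bool.Properties using () renaming (_≟_ to _≟ᵇ_)
open import Data.Integer using (+_; -_; _+_; _-_; _⊔_; 0ℤ; 1ℤ) renaming (_≤_ to _≤ℤ_; _<_ to _<ℤ_)
open Data.Integer._≤_ using (-≤-)
import Data.Integer.Properties as ℤ
open import Data.List using (List; []; _∷_; length; map; filter; deduplicate)
open import Data.List.Properties using (length-filter; length-deduplicate)
open import Data.List.Membership.Propositional using (_∈_)
open import Data.List.Membership.Propositional.Properties
  using (∈-map⁺; ∈-filter⁺; ∈-filter⁻; ∈-deduplicate⁺; ∈-deduplicate⁻)
open import Data.List.Relation.Unary.Any using (here; there)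
open import Data.List.Relation.Unary.Unique.DecPropositional.Properties using (deduplicate-!)
open import Data.Nat using (s≤s; z≤n)
import Data.Nat.Properties as ℕ
open import Data.Product using (_,_; proj₁; proj₂)
open import Data.Product.Properties using (≡-dec)
open import Data.Sum using (_⊎_; inj₁; inj₂)
open import Relation.Binary.Construct.Closure.ReflexiveTransitive using (ε; _◅_)
open import Relation.Binary.Definitions using (DecidableEquality)
open import Relation.Unary using (Decidable)
open import Relation.Binary.PropositionalEquality using (_≡_; refl; sym; trans; cong; subst)

_≟ₚ_ : DecidableEquality Pt
_≟ₚ_ = ≡-dec ℤ._≟_ (≡-dec ℤ._≟_ ℤ._≟_)

pt≡ : ∀ {i i′ j j′ k k′ : ℤ} → i ≡ i′ → j ≡ j′ → k ≡ k′ → (i , j , k) ≡ (i′ , j′ , k′)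
pt≡ refl refl refl = refl

i-1+1≡i : ∀ i → i - 1ℤ + 1ℤ ≡ i
i-1+1≡i i = trans (ℤ.+-assoc i (- 1ℤ) 1ℤ) (ℤ.+-identityʳ i)

i-1≤i : ∀ i → i - 1ℤ ≤ℤ i
i-1≤i i = ℤ.i-j≤i i 1ℤ

i≤j-1⇒i<j : ∀ {i j} → i ≤ℤ j - 1ℤ → i <ℤ j
i≤j-1⇒i<j {i} {j} i≤j-1 = ℤ.i≤pred[j]⇒i<j (subst (i ≤ℤ_) (ℤ.+-comm j (- 1ℤ)) i≤j-1)

data Corner : Set where
  c₁ c₂ c₃ c₂₃ c₁₃ c₁₂ : Corner

corners : List Corner
corners = c₁ ∷ c₂ ∷ c₃ ∷ c₂₃ ∷ c₁₃ ∷ c₁₂ ∷ []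

∈-corners : ∀ c → c ∈ corners
∈-corners c₁  = here refl
∈-corners c₂  = there (here refl)
∈-corners c₃  = there (there (here refl))
∈-corners c₂₃ = there (there (there (here refl)))
∈-corners c₁₃ = there (there (there (there (here refl))))
∈-corners c₁₂ = there (there (there (there (there (here refl)))))

corner : Corner → Pt → Pt
corner c₁  (i , j , k) = i + 1ℤ , j , k
corner c₂  (i , j , k) = i , j + 1ℤ , k
corner c₃  (i , j , k) = i , j , k + 1ℤ
corner c₂₃ (i , j , k) = i , j + 1ℤ , k + 1ℤ
corner c₁₃ (i , j , k) = i + 1ℤ , j , k + 1ℤ
corner c₁₂ (i , j , k) = i + 1ℤ , j + 1ℤ , k

-- The Bool is whether corner c v lies in 𝓛.
towards : Corner → Bool → Pt → Pt
towards c₁  true  (i , j , k) = i + 1ℤ , j , k - 1ℤ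
towards c₁  false (i , j , k) = i , j - 1ℤ , k - 1ℤ
towards c₂  true  (i , j , k) = i - 1ℤ , j + 1ℤ , k
towards c₂  false (i , j , k) = i - 1ℤ , j , k - 1ℤ
towards c₃  true  (i , j , k) = i , j - 1ℤ , k + 1ℤ
towards c₃  false (i , j , k) = i - 1ℤ , j - 1ℤ , k
towards c₂₃ true  (i , j , k) = i , j + 1ℤ , k + 1ℤ
towards c₂₃ false (i , j , k) = i - 1ℤ , j , k + 1ℤ
towards c₁₃ true  (i , j , k) = i + 1ℤ , j , k + 1ℤ
towards c₁₃ false (i , j , k) = i + 1ℤ , j - 1ℤ , k
towards c₁₂ true  (i , j , k) = i + 1ℤ , j + 1ℤ , k
towards c₁₂ false (i , j , k) = i , j + 1ℤ , k - 1ℤ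

module _ (L : Pt → Bool) where

  neighbour : Pt → Corner → Pt
  neighbour v c = towards c (L (corner c v)) v

  neighbours : Pt → List Pt
  neighbours v = map (neighbour v) corners

  towards⇒neighbour : ∀ {v w b} c → L (corner c v) ≡ b → w ≡ towards c b v → w ≡ neighbour v c
  towards⇒neighbour c refl w≡ = w≡

  L-resp : ∀ {p q b} → p ≡ q → L p ≡ b → L q ≡ b
  L-resp p≡q = subst (λ x → L x ≡ _) p≡q

  -- In each case the hinge is the corner whose membership in 𝓛 is forced by the rhombus:
  -- its top lies in 𝓛, and its bottom is in 𝓘, so bottom + (1,1,1) lies outside 𝓛.
  GEdge⇒neighbour : ∀ {v w} → GEdge L v w → Σ Corner λ c → w ≡ neighbour v c
  GEdge⇒neighbour (ra , (i , j , k) , (top , _ , _ , bot) , edge) with edge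
  ... | inj₁ (inj₁ refl) = c₁₂ , towards⇒neighbour c₁₂
      (L-resp (pt≡ refl refl (i-1+1≡i k)) (proj₂ bot))
      (pt≡ refl (sym (i-1+1≡i j)) refl)
  ... | inj₁ (inj₂ refl) = c₃ , towards⇒neighbour c₃
      (L-resp (pt≡ refl refl (sym (i-1+1≡i k))) (proj₁ top))
      (pt≡ refl refl (sym (i-1+1≡i k)))
  ... | inj₂ (inj₁ refl) = c₁ , towards⇒neighbour c₁
      (L-resp (pt≡ refl (i-1+1≡i j) (i-1+1≡i k)) (proj₂ bot)) refl
  ... | inj₂ (inj₂ refl) = c₂₃ , towards⇒neighbour c₂₃ (L-resp up (proj₁ top)) up
    where up = pt≡ refl (sym (i-1+1≡i j)) (sym (i-1+1≡i k))
  GEdge⇒neighbour (rb , (i , j , k) , (top , _ , _ , bot) , edge) with edge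
  ... | inj₁ (inj₁ refl) = c₁ , towards⇒neighbour c₁
      (L-resp (pt≡ (sym (i-1+1≡i i)) refl refl) (proj₁ top))
      (pt≡ (sym (i-1+1≡i i)) refl refl)
  ... | inj₁ (inj₂ refl) = c₂₃ , towards⇒neighbour c₂₃
      (L-resp (pt≡ (i-1+1≡i i) refl refl) (proj₂ bot))
      (pt≡ refl refl (sym (i-1+1≡i k)))
  ... | inj₂ (inj₁ refl) = c₂ , towards⇒neighbour c₂
      (L-resp (pt≡ (i-1+1≡i i) refl (i-1+1≡i k)) (proj₂ bot)) refl
  ... | inj₂ (inj₂ refl) = c₁₃ , towards⇒neighbour c₁₃ (L-resp up (proj₁ top)) up
    where up = pt≡ (sym (i-1+1≡i i)) refl (sym (i-1+1≡i k))
  GEdge⇒neighbour (rc , (i , j , k) , (top , _ , _ , bot) , edge) with edge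
  ... | inj₁ (inj₁ refl) = c₁₃ , towards⇒neighbour c₁₃
      (L-resp (pt≡ refl (i-1+1≡i j) refl) (proj₂ bot))
      (pt≡ (sym (i-1+1≡i i)) refl refl)
  ... | inj₁ (inj₂ refl) = c₂ , towards⇒neighbour c₂
      (L-resp (pt≡ refl (sym (i-1+1≡i j)) refl) (proj₁ top))
      (pt≡ refl (sym (i-1+1≡i j)) refl)
  ... | inj₂ (inj₁ refl) = c₃ , towards⇒neighbour c₃
      (L-resp (pt≡ (i-1+1≡i i) (i-1+1≡i j) refl) (proj₂ bot)) refl
  ... | inj₂ (inj₂ refl) = c₁₂ , towards⇒neighbour c₁₂ (L-resp up (proj₁ top)) up
    where up = pt≡ (sym (i-1+1≡i i)) (sym (i-1+1≡i j)) refl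

  GEdge⇒∈neighbours : ∀ {v w} → GEdge L v w → w ∈ neighbours v
  GEdge⇒∈neighbours e with GEdge⇒neighbour e
  ... | c , refl = ∈-map⁺ (neighbour _) (∈-corners c)

module _ (E : Pt → Pt → Bool) (v : Pt) where

  HasDegree-≤-cover : (cs : List Pt) → (∀ w → E v w ≡ true → w ∈ cs) →
                      Σ ℕ λ d → HasDegree E v d × d ≤ length cs
  HasDegree-≤-cover cs cover =
    length ws , (ws , deduplicate-! _≟ₚ_ adjacent , sound , complete , refl) ,
    ℕ.≤-trans (length-deduplicate _≟ₚ_ adjacent) (length-filter adjacent? cs)
    where
    adjacent? : Decidable (λ w → E v w ≡ true)
    adjacent? w = E v w ≟ᵇ true
    adjacent ws : List Pt
    adjacent = filter adjacent? cs
    ws = deduplicate _≟ₚ_ adjacent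
    sound : ∀ w → w ∈ ws → E v w ≡ true
    sound w w∈ = proj₂ (∈-filter⁻ adjacent? {xs = cs} (∈-deduplicate⁻ _≟ₚ_ adjacent w∈))
    complete : ∀ w → E v w ≡ true → w ∈ ws
    complete w e = ∈-deduplicate⁺ _≟ₚ_ (∈-filter⁺ adjacent? (cover w e) e)

  HasDegree-positive : ∀ {d w} → HasDegree E v d → E v w ≡ true → 1 ≤ d
  HasDegree-positive (ws , _ , _ , complete , refl) e with complete _ e
  ... | here _  = s≤s z≤n
  ... | there _ = s≤s z≤n

facePoint : RType → ℤ → ℤ → Pt
facePoint ra a b = 0ℤ , a , b
facePoint rb a b = a , 0ℤ , b
facePoint rc a b = a , b , 0ℤ

rverts-facePoint : ∀ t a b → rverts t (facePoint t a b) ≡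
  four (facePoint t a b) (facePoint t (a - 1ℤ) b) (facePoint t a (b - 1ℤ)) (facePoint t (a - 1ℤ) (b - 1ℤ))
rverts-facePoint ra a b = refl
rverts-facePoint rb a b = refl
rverts-facePoint rc a b = refl

shortEdge-facePoint : ∀ t a b →
  shortEdge t (facePoint t a b) ≡ (facePoint t a b , facePoint t (a - 1ℤ) (b - 1ℤ))
shortEdge-facePoint ra a b = refl
shortEdge-facePoint rb a b = refl
shortEdge-facePoint rc a b = refl

coordSum-facePoint : ∀ t a b → coordSum (facePoint t a b) ≡ a + b
coordSum-facePoint ra a b = cong (_+ b) (ℤ.+-identityˡ a)
coordSum-facePoint rb a b = cong (_+ b) (ℤ.+-identityʳ a)
coordSum-facePoint rc a b = ℤ.+-identityʳ (a + b)

maxCoord : Pt → ℤ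
maxCoord (i , j , k) = (i ⊔ j) ⊔ k

maxCoord-facePoint : ∀ t {a b} → a ≤ℤ 0ℤ → b ≤ℤ 0ℤ → maxCoord (facePoint t a b) ≡ 0ℤ
maxCoord-facePoint ra a≤0 b≤0 = trans (cong (_⊔ _) (ℤ.i≥j⇒i⊔j≡i a≤0)) (ℤ.i≥j⇒i⊔j≡i b≤0)
maxCoord-facePoint rb a≤0 b≤0 = trans (cong (_⊔ _) (ℤ.i≤j⇒i⊔j≡j a≤0)) (ℤ.i≥j⇒i⊔j≡i b≤0)
maxCoord-facePoint rc a≤0 b≤0 = ℤ.i≤j⇒i⊔j≡j (ℤ.⊔-lub a≤0 b≤0)

facePoint-≼-origin : ∀ t {a b} → facePoint t a b ≼ origin → a ≤ℤ 0ℤ × b ≤ℤ 0ℤ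
facePoint-≼-origin ra (_ , a≤0 , b≤0) = a≤0 , b≤0
facePoint-≼-origin rb (a≤0 , _ , b≤0) = a≤0 , b≤0
facePoint-≼-origin rc (a≤0 , b≤0 , _) = a≤0 , b≤0

AllFour-facePoint : ∀ (P : Pt → Set) t a b →
  (∀ {a′ b′} → a′ ≤ℤ a → b′ ≤ℤ b → P (facePoint t a′ b′)) → AllFour P (rverts t (facePoint t a b))
AllFour-facePoint P t a b below = subst (AllFour P) (sym (rverts-facePoint t a b))
  (below ℤ.≤-refl ℤ.≤-refl , below (i-1≤i a) ℤ.≤-refl ,
   below ℤ.≤-refl (i-1≤i b) , below (i-1≤i a) (i-1≤i b))

below-cutoff : ∀ {y x} → (x ≡ y - 1ℤ) ⊎ (x ≡ y - + 2) → x <ℤ y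
below-cutoff (inj₁ refl) = i≤j-1⇒i<j ℤ.≤-refl
below-cutoff {y} (inj₂ refl) = i≤j-1⇒i<j (ℤ.+-monoʳ-≤ y (-≤- z≤n))

distinguished-facePoint : ∀ {N} s → ValidB N s →
  Σ RType λ t → Σ ℤ λ a → Σ ℤ λ b → MemB s (facePoint t a b) × a + b <ℤ - N
distinguished-facePoint (pairA p q) (_ , _ , p+q) = ra , p , q , inj₁ refl , below-cutoff p+q
distinguished-facePoint (pairB p q) (_ , _ , p+q) = rc , p , q , inj₁ refl , below-cutoff p+q
distinguished-facePoint (pairC p q) (_ , _ , p+q) =
  rb , q , p , inj₁ refl , subst (_<ℤ _) (ℤ.+-comm p q) (below-cutoff p+q)
distinguished-facePoint (triple p) p+p = ra , p , p , inj₁ refl , below-cutoff p+p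
distinguished-facePoint (singleA q) q≤ =
  ra , 0ℤ , q , refl , subst (_<ℤ _) (sym (ℤ.+-identityˡ q)) (i≤j-1⇒i<j q≤)
distinguished-facePoint (singleB q) q≤ =
  ra , q , 0ℤ , refl , subst (_<ℤ _) (sym (ℤ.+-identityʳ q)) (i≤j-1⇒i<j q≤)
distinguished-facePoint (singleC q) q≤ =
  rb , q , 0ℤ , refl , subst (_<ℤ _) (sym (ℤ.+-identityʳ q)) (i≤j-1⇒i<j q≤)

module _ (L : Pt → Bool) (inside : InsideOrigin L) (N : ℤ) (cut : IsCutoff L N)
         (E : Pt → Pt → Bool) (G : IsGrove L N E) where
  open IsGrove G

  cutoff-InI : ∀ v → coordSum v ≤ℤ - N → maxCoord v ≡ 0ℤ → InI L v
  cutoff-InI (i , j , k) = proj₁ cut i j k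

  far-face-edge : ∀ t {a b} → a ≤ℤ 0ℤ → b ≤ℤ 0ℤ → a + b <ℤ - N →
                  E (facePoint t a b) (facePoint t (a - 1ℤ) (b - 1ℤ)) ≡ true
  far-face-edge t {a} {b} a≤0 b≤0 far =
    subst (EdgeIn E) (shortEdge-facePoint t a b)
      (farShort t (facePoint t a b)
        (AllFour-facePoint (InI L) t a b λ a′≤a b′≤b →
          cutoff-InI _ (ℤ.<⇒≤ (sum-far a′≤a b′≤b))
                       (maxCoord-facePoint t (ℤ.≤-trans a′≤a a≤0) (ℤ.≤-trans b′≤b b≤0)))
        (AllFour-facePoint (λ w → coordSum w <ℤ - N) t a b sum-far))
    where
    sum-far : ∀ {a′ b′} → a′ ≤ℤ a → b′ ≤ℤ b → coordSum (facePoint t a′ b′) <ℤ - N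
    sum-far {a′} {b′} a′≤a b′≤b =
      subst (_<ℤ - N) (sym (coordSum-facePoint t a′ b′)) (ℤ.≤-<-trans (ℤ.+-mono-≤ a′≤a b′≤b) far)

  has-neighbour : ∀ v → InI L v → Σ Pt λ w → E v w ≡ true
  has-neighbour v v∈I with exactlyOneSet v v∈I
  ... | s , valid , v~s , _ with distinguished-facePoint s valid
  ... | t , a , b , w∈s , far with v~s _ w∈s
  ...   | e ◅ _ = _ , e
  ...   | ε = let a≤0 , b≤0 = facePoint-≼-origin t (inside _ (proj₁ v∈I))
              in _ , far-face-edge t a≤0 b≤0 far

mainTheorem8 : (L : Pt → Bool) → IsOrderIdeal L → InsideOrigin L → FiniteUBelowOrigin L →
    (N : ℤ) → IsCutoff L N → (E : Pt → Pt → Bool) → IsGrove L N E →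
    ∀ v → InI L v → Σ ℕ λ d → HasDegree E v d × 1 ≤ d × d ≤ 6
mainTheorem8 L _ inside _ N cut E G v v∈I =
  let d , deg , d≤6 = HasDegree-≤-cover E v (neighbours L v)
                        (λ w e → GEdge⇒∈neighbours L (IsGrove.subgraph G v w e))
      w , e = has-neighbour L inside N cut E G v v∈I
  in d , deg , HasDegree-positive E v deg e , d≤6
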